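{- For every integer $n>8$ there are at least eighteen prime numbers $p$ with $n<p<9n$. -}

module Defs where

-- Let 2 ^ (t - 1) ≤ n < 2 ^ t and N = 2 ^ (t + 2) ≤ 8 n. By the Leibniz harmonic triangle,
-- m * ((2 m) C m) divides every common multiple of 1 .. 2 m, so such a multiple is at least
-- 2 ^ (N - 1) when 2 m = N. One such multiple is the product of: for each b ≤ 2 ^ h (where
-- N ≤ 4 ^ h), the largest power of b up to N; a multiple of the primes up to 2 ^ t that is at
-- most 4 ^ (2 ^ t); and the primes p with n < p ≤ N. If there were at most 17 of the latter,
-- it would be at most N ^ (2 ^ h + 17) * 4 ^ (2 ^ t), which is too small once t ≥ 10.
-- The intervals (10 , 80], (18 , 98], (78 , 170] and (600 , 710] settle n ≤ 600.
module Submission where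

open import Defs
open import Data.Nat using (ℕ; _*_; _≤_; _<_; _>_)
open import Data.Nat.Primality using (Prime)
open import Data.List using (List; length)
open import Data.List.Relation.Unary.All using (All)
open import Data.List.Relation.Unary.Unique.Propositional using (Unique)
open import Data.Product using (_×_; Σ-syntax)

open import Data.Empty using (⊥-elim)
open import Data.List using ([]; _∷_; filter; applyUpTo)
open import Data.List.Membership.Propositional using (_∈_)
open import Data.List.Membership.Propositional.Properties using (∈-filter⁺; ∈-applyUpTo⁺)
import Data.List.Relation.Unary.All as All
import Data.List.Relation.Unary.All.Properties as All
import Data.List.Relation.Unary.Unique.Propositional.Properties as Unique
open import Data.Nat using (zero; suc; _+_; _∸_; _^_; _!; NonZero; NonTrivial; z≤n; s≤s; z<s; s<s; _≤?_; _<?_; ⌊_/2⌋; ⌈_/2⌉; >-nonZero; nonTrivial⇒n>1)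
open import Data.Nat.Combinatorics hiding (_P_)
open import Data.Nat.Divisibility
open import Data.Nat.DivMod using (m/n*n≡m)
open import Data.Nat.Induction using (<-rec)
open import Data.Nat.ListAction using (product)
open import Data.Nat.ListAction.Properties using (∈⇒∣product)
open import Data.Nat.Primality using (prime?; ¬prime[1]; euclidsLemma; prime⇒nonZero; prime⇒nonTrivial)
open import Data.Nat.Primality.Factorisation using (factorise)
open import Data.Nat.Properties
open import Data.Nat.Tactic.RingSolver using (solve-∀)
open import Data.Product using (_,_; ∃-syntax; proj₁; proj₂)
open import Data.Sum using (inj₁; inj₂)
open import Relation.Binary.PropositionalEquality using (_≡_; refl; sym; trans; cong; cong₂; subst; subst₂)
open import Relation.Nullary using (yes; no)
open import Relation.Nullary.Decidable using (from-yes)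

open ≤-Reasoning

-- Binomial coefficients

-- The absorption identity. Induction with Pascal's rule, instead of factorials, gives it without
-- assuming `k ≤ n`.
[k+1]*[n+1]C[k+1]≡[n+1]*nCk : ∀ n k → suc k * (suc n C suc k) ≡ suc n * (n C k)
[k+1]*[n+1]C[k+1]≡[n+1]*nCk n zero = trans (*-identityˡ (suc n C 1)) (trans (nC1≡n (suc n)) (sym (*-identityʳ (suc n))))
[k+1]*[n+1]C[k+1]≡[n+1]*nCk zero (suc k) = trans
  (cong (suc (suc k) *_) (k>n⇒nCk≡0 {1} {suc (suc k)} (s<s z<s)))
  (trans (*-zeroʳ (suc (suc k))) (sym (trans (*-identityˡ (0 C suc k)) (k>n⇒nCk≡0 {0} {suc k} z<s))))
[k+1]*[n+1]C[k+1]≡[n+1]*nCk (suc n) (suc k) = begin-equality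
  (2 + k) * ((2 + n) C (2 + k))
    ≡⟨ cong ((2 + k) *_) (nCk+nC[k+1]≡[n+1]C[k+1] (suc n) (suc k)) ⟨
  (2 + k) * (b + suc n C (2 + k))
    ≡⟨ *-distribˡ-+ (2 + k) b (suc n C (2 + k)) ⟩
  b + suc k * b + (2 + k) * (suc n C (2 + k))
    ≡⟨ cong₂ (λ x y → b + x + y) ([k+1]*[n+1]C[k+1]≡[n+1]*nCk n k) ([k+1]*[n+1]C[k+1]≡[n+1]*nCk n (suc k)) ⟩
  b + suc n * (n C k) + suc n * (n C suc k)
    ≡⟨ +-assoc b (suc n * (n C k)) (suc n * (n C suc k)) ⟩
  b + (suc n * (n C k) + suc n * (n C suc k))
    ≡⟨ cong (b +_) (*-distribˡ-+ (suc n) (n C k) (n C suc k)) ⟨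
  b + suc n * (n C k + n C suc k)
    ≡⟨ cong (λ x → b + suc n * x) (nCk+nC[k+1]≡[n+1]C[k+1] n k) ⟩
  (2 + n) * b
    ∎
  where b = suc n C suc k

nCk≤2^n : ∀ n k → n C k ≤ 2 ^ n
nCk≤2^n n zero = m^n>0 2 n
nCk≤2^n zero (suc k) = ≤-trans (≤-reflexive (k>n⇒nCk≡0 {0} {suc k} z<s)) z≤n
nCk≤2^n (suc n) (suc k) = begin
  suc n C suc k       ≡⟨ nCk+nC[k+1]≡[n+1]C[k+1] n k ⟨
  n C k + n C suc k   ≤⟨ +-mono-≤ (nCk≤2^n n k) (nCk≤2^n n (suc k)) ⟩
  2 ^ n + 2 ^ n       ≡⟨ cong (2 ^ n +_) (+-identityʳ (2 ^ n)) ⟨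
  2 ^ suc n           ∎

nCk*k![n∸k]!≡n! : ∀ {n k} → k ≤ n → (n C k) * (k ! * (n ∸ k) !) ≡ n !
nCk*k![n∸k]!≡n! {n} {k} k≤n = trans (cong (_* (k ! * (n ∸ k) !)) (nCk≡n!/k![n-k]! k≤n)) (m/n*n≡m (k![n∸k]!∣n! k≤n))
  where instance _ = k !* (n ∸ k) !≢0

2[1+m]≡2+2m : ∀ m → 2 * suc m ≡ suc (suc (2 * m))
2[1+m]≡2+2m = solve-∀

-- Passing from `m` to `suc m` multiplies the left side by 4. By Pascal, symmetry and absorption the
-- new right side is `2 * (2 m + 3) * c`, which is at least 4 times the old one, `suc m * c`.
2^[2m+1]≤[m+1]*[2m+2]C[m+1] : ∀ m → 2 ^ suc (2 * m) ≤ suc m * (suc (suc (2 * m)) C suc m)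
2^[2m+1]≤[m+1]*[2m+2]C[m+1] zero = ≤-refl
2^[2m+1]≤[m+1]*[2m+2]C[m+1] (suc m) = begin
  2 ^ suc (2 * suc m)
    ≡⟨ cong (λ x → 2 ^ suc x) (2[1+m]≡2+2m m) ⟩
  2 * (2 * 2 ^ suc (2 * m))
    ≤⟨ *-monoʳ-≤ 2 (*-monoʳ-≤ 2 (2^[2m+1]≤[m+1]*[2m+2]C[m+1] m)) ⟩
  2 * (2 * (suc m * c))
    ≤⟨ *-monoʳ-≤ 2 (≤-trans (≤-reflexive (regroup m c)) (*-monoˡ-≤ c (n≤1+n (suc (suc (2 * m)))))) ⟩
  2 * (suc n * c)
    ≡⟨ cong (2 *_) ([k+1]*[n+1]C[k+1]≡[n+1]*nCk n (suc m)) ⟨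
  2 * (suc (suc m) * d)
    ≡⟨ distribute (suc (suc m)) d ⟩
  suc (suc m) * (d + d)
    ≡⟨ cong (λ x → suc (suc m) * (x + d)) symmetric ⟩
  suc (suc m) * (suc n C suc m + d)
    ≡⟨ cong (suc (suc m) *_) (nCk+nC[k+1]≡[n+1]C[k+1] (suc n) (suc m)) ⟩
  suc (suc m) * (suc (suc n) C suc (suc m))
    ≡⟨ cong (λ x → suc (suc m) * (suc (suc x) C suc (suc m))) (2[1+m]≡2+2m m) ⟨
  suc (suc m) * (suc (suc (2 * suc m)) C suc (suc m))
    ∎
  where
  n = suc (suc (2 * m))
  c = n C suc m
  d = suc n C suc (suc m)
  regroup : ∀ m c → 2 * (suc m * c) ≡ suc (suc (2 * m)) * c
  regroup = solve-∀
  distribute : ∀ m d → 2 * (m * d) ≡ m * (d + d)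
  distribute = solve-∀
  split : ∀ m → suc (suc (suc (2 * m))) ≡ suc m + suc (suc m)
  split = solve-∀
  symmetric : d ≡ suc n C suc m
  symmetric = trans
    (nCk≡nC[n∸k] {suc (suc m)} {suc n} (subst (suc (suc m) ≤_) (sym (split m)) (m≤n+m (suc (suc m)) (suc m))))
    (cong (suc n C_) (trans (cong (_∸ suc (suc m)) (split m)) (m+n∸n≡m (suc m) (suc (suc m)))))

-- With B n k = 1 / (k * (n C k)), this is the rule B (n+1) (k+1) = B n k - B (n+1) k
-- of the Leibniz harmonic triangle, multiplied by q.
k*nCk∣ : ∀ {N q} → (∀ i → 1 ≤ i → i ≤ N → i ∣ q) →
         ∀ k n → suc k ≤ n → n ≤ N → suc k * (n C suc k) ∣ q
k*nCk∣ {N} {q} h zero n 1≤n n≤N = subst (_∣ q) (sym (trans (*-identityˡ (n C 1)) (nC1≡n n))) (h n 1≤n n≤N)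
k*nCk∣ {N} {q} h (suc k) (suc n) (s≤s k<n) n<N
  with k*nCk∣ h k n k<n (<⇒≤ n<N) | k*nCk∣ h k (suc n) (m≤n⇒m≤1+n k<n) n<N
... | divides y q≡yB | divides z q≡zB = divides (y ∸ z) (sym (begin-equality
  (y ∸ z) * (suc (suc k) * (suc n C suc (suc k)))
    ≡⟨ cong ((y ∸ z) *_) ([k+1]*[n+1]C[k+1]≡[n+1]*nCk n (suc k)) ⟩
  (y ∸ z) * (suc n * b)
    ≡⟨ swap (y ∸ z) (suc n) b ⟩
  suc n * ((y ∸ z) * b)
    ≡⟨ cong (suc n *_) [y∸z]b≡zc ⟩
  suc n * (z * c)
    ≡⟨ swap (suc n) z c ⟩
  z * (suc n * c)
    ≡⟨ cong (z *_) ([k+1]*[n+1]C[k+1]≡[n+1]*nCk n k) ⟨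
  z * (suc k * (suc n C suc k))
    ≡⟨ q≡zB ⟨
  q ∎))
  where
  b = n C suc k
  c = n C k
  swap : ∀ x y z → x * (y * z) ≡ y * (x * z)
  swap = solve-∀
  yb≡z[c+b] : y * b ≡ z * (c + b)
  yb≡z[c+b] = *-cancelˡ-≡ (y * b) (z * (c + b)) (suc k) (begin-equality
    suc k * (y * b)              ≡⟨ swap (suc k) y b ⟩
    y * (suc k * b)              ≡⟨ q≡yB ⟨
    q                            ≡⟨ q≡zB ⟩
    z * (suc k * (suc n C suc k)) ≡⟨ swap z (suc k) _ ⟩
    suc k * (z * (suc n C suc k)) ≡⟨ cong (λ x → suc k * (z * x)) (nCk+nC[k+1]≡[n+1]C[k+1] n k) ⟨
    suc k * (z * (c + b))        ∎)
  -- Truncated subtraction loses nothing, because `y * b` is `z * b` plus `z * c`.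
  [y∸z]b≡zc : (y ∸ z) * b ≡ z * c
  [y∸z]b≡zc = begin-equality
    (y ∸ z) * b           ≡⟨ *-distribʳ-∸ b y z ⟩
    y * b ∸ z * b         ≡⟨ cong (_∸ z * b) (trans yb≡z[c+b] (*-distribˡ-+ z c b)) ⟩
    z * c + z * b ∸ z * b ≡⟨ m+n∸n≡m (z * c) (z * b) ⟩
    z * c                 ∎

-- The divisor of `q` used is the central one, at `suc m` in row `2 * suc m`.
commonMultiple≥ : ∀ m {q} .{{_ : NonZero q}} → (∀ i → 1 ≤ i → i ≤ 2 * suc m → i ∣ q) →
                  2 ^ suc (2 * m) ≤ q
commonMultiple≥ m {q} h = ≤-trans (2^[2m+1]≤[m+1]*[2m+2]C[m+1] m)
  (∣⇒≤ (k*nCk∣ (λ i 1≤i i≤ → h i 1≤i (subst (i ≤_) (sym (2[1+m]≡2+2m m)) i≤)) m _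
    (s≤s (m≤n⇒m≤1+n (m≤m+n m (m + 0)))) ≤-refl))

-- Divisibility by primes and prime powers

prime∣n!⇒≤ : ∀ {p} → Prime p → ∀ n → p ∣ n ! → p ≤ n
prime∣n!⇒≤ pp zero p∣1 = ⊥-elim (¬prime[1] (subst Prime (∣1⇒≡1 p∣1) pp))
prime∣n!⇒≤ pp (suc n) p∣ with euclidsLemma (suc n) (n !) pp p∣
... | inj₁ p∣sn = ∣⇒≤ p∣sn
... | inj₂ p∣n! = m≤n⇒m≤1+n (prime∣n!⇒≤ pp n p∣n!)

m≤n⇒m∣n! : ∀ {m n} .{{_ : NonZero m}} → m ≤ n → m ∣ n !
m≤n⇒m∣n! {suc m} m≤n = ∣-trans (m∣m*n (m !)) (m≤n⇒m!∣n! m≤n)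

-- The prime divides `(2 * m) !`, which is the coefficient times `m !` twice, but being larger than
-- `m` it does not divide `m !`.
prime∣2mCm : ∀ {p} m → Prime p → m < p → p ≤ 2 * m → p ∣ (2 * m) C m
prime∣2mCm {p} m pp m<p p≤2m
  with euclidsLemma ((2 * m) C m) (m ! * (2 * m ∸ m) !) pp
         (subst (p ∣_) (sym (nCk*k![n∸k]!≡n! (m≤m+n m (m + 0)))) (m≤n⇒m∣n! {{prime⇒nonZero pp}} p≤2m))
... | inj₁ p∣C = p∣C
... | inj₂ p∣!! with euclidsLemma (m !) ((2 * m ∸ m) !) pp p∣!!
...   | inj₁ p∣m! = ⊥-elim (<⇒≱ m<p (prime∣n!⇒≤ pp m p∣m!))
...   | inj₂ p∣m!′ = ⊥-elim (<⇒≱ m<p (subst (p ≤_) 2m∸m≡m (prime∣n!⇒≤ pp _ p∣m!′)))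
  where
  2m∸m≡m : 2 * m ∸ m ≡ m
  2m∸m≡m = trans (m+n∸m≡n m (m + 0)) (+-identityʳ m)

-- Euclid's lemma puts one factor `p` into `m`; cancel it on both sides and repeat.
p^a∣m*n⇒p^a∣m : ∀ {p} → Prime p → ∀ a m {n} → p ∤ n → p ^ a ∣ m * n → p ^ a ∣ m
p^a∣m*n⇒p^a∣m pp zero m p∤n _ = 1∣ m
p^a∣m*n⇒p^a∣m {p} pp (suc a) m {n} p∤n d with euclidsLemma m n pp (m*n∣⇒m∣ p (p ^ a) d)
... | inj₂ p∣n = ⊥-elim (p∤n p∣n)
... | inj₁ (divides m′ refl) = subst (p ^ suc a ∣_) (*-comm p m′)
  (*-monoʳ-∣ p (p^a∣m*n⇒p^a∣m pp a m′ p∤n (*-cancelˡ-∣ p (subst (p ^ suc a ∣_) (rearrange m′ p n) d))))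
  where
  instance _ = prime⇒nonZero pp
  rearrange : ∀ m p n → m * p * n ≡ p * (m * n)
  rearrange = solve-∀

extractPower : ∀ p .{{_ : NonTrivial p}} n .{{_ : NonZero n}} →
               ∃[ a ] ∃[ m ] (n ≡ m * p ^ a × p ∤ m)
extractPower p = <-rec _ go
  where
  go : ∀ n → (∀ {m} → m < n → .{{_ : NonZero m}} → ∃[ a ] ∃[ k ] (m ≡ k * p ^ a × p ∤ k)) →
       .{{_ : NonZero n}} → ∃[ a ] ∃[ k ] (n ≡ k * p ^ a × p ∤ k)
  go n rec with p ∣? n
  ... | no p∤n = 0 , n , sym (*-identityʳ n) , p∤n
  ... | yes p∣n with rec (quotient-< p∣n) {{quotient≢0 p∣n}}
  ...   | a , k , q≡ , p∤k = suc a , k , trans (m∣n⇒n≡quotient*m p∣n)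
            (trans (cong (_* p) q≡) (trans (*-assoc k (p ^ a) p) (cong (k *_) (*-comm (p ^ a) p)))) , p∤k

primeDivisor : ∀ n → 1 < n → ∃[ p ] (Prime p × p ∣ n)
primeDivisor n 1<n with factorise n {{>-nonZero (<⇒≤ 1<n)}}
... | record { factors = [] ; isFactorisation = n≡1 } = ⊥-elim (<-irrefl (sym n≡1) 1<n)
... | record { factors = p ∷ ps ; isFactorisation = n≡ ; factorsPrime = pp All.∷ _ } =
  p , pp , subst (p ∣_) (sym n≡) (m∣m*n (product ps))

-- Split off a full prime power, `n ≡ m * p ^ suc a` with `p ∤ m`. By strong induction `q ≡ r * m`,
-- and `p ^ suc a`, dividing `r * m`, must divide `r`. So a common multiple only has to be checked
-- on prime powers.
primePowers∣⇒∣ : ∀ q n .{{_ : NonZero n}} → (∀ p a → Prime p → p ^ a ∣ n → p ^ a ∣ q) → n ∣ q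
primePowers∣⇒∣ q = <-rec _ go
  where
  go : ∀ n → (∀ {m} → m < n → .{{_ : NonZero m}} → (∀ p a → Prime p → p ^ a ∣ m → p ^ a ∣ q) → m ∣ q) →
       .{{_ : NonZero n}} → (∀ p a → Prime p → p ^ a ∣ n → p ^ a ∣ q) → n ∣ q
  go 1 rec h = 1∣ q
  go n@(suc (suc _)) rec h with primeDivisor n (s<s z<s)
  ... | p , pp , p∣n with extractPower p {{prime⇒nonTrivial pp}} n
  ...   | zero , m , n≡ , p∤m = ⊥-elim (p∤m (subst (p ∣_) (trans n≡ (*-identityʳ m)) p∣n))
  ...   | suc a , zero , n≡ , p∤m = ⊥-elim (p∤m (p ∣0))
  ...   | suc a , m@(suc m-1) , n≡ , p∤m = goal
    where
    instance _ = prime⇒nonTrivial pp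
    m∣n : m ∣ n
    m∣n = subst (m ∣_) (sym n≡) (m∣m*n (p ^ suc a))
    m<n : m < n
    m<n = subst (m <_) (sym n≡) (m<m*n m (p ^ suc a)
      (≤-trans (s≤s (m^n>0 p {{prime⇒nonZero pp}} 0)) (^-monoʳ-< p (nonTrivial⇒n>1 p) {0} {suc a} z<s)))
    goal : n ∣ q
    goal with rec m<n (λ r b pr d → h r b pr (∣-trans d m∣n))
    ... | divides r q≡ = subst₂ _∣_ (sym n≡) (sym q≡)
      (subst (_∣ r * m) (*-comm (p ^ suc a) m)
        (*-monoˡ-∣ m (p^a∣m*n⇒p^a∣m pp (suc a) r p∤m
          (subst (p ^ suc a ∣_) q≡ (h p (suc a) pp (subst (p ^ suc a ∣_) (sym n≡) (n∣m*n m)))))))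

-- Factors of a small common multiple: powers of small bases, and all small primes

powersOf : ∀ N e b .{{_ : NonZero N}} .{{_ : NonZero b}} →
           ∃[ P ] (NonZero P × P ≤ N × (∀ a → a ≤ e → b ^ a ≤ N → b ^ a ∣ P))
powersOf N@(suc _) zero b = 1 , _ , s≤s z≤n , λ { zero _ _ → ∣-refl }
powersOf N (suc e) b with b ^ suc e ≤? N
... | yes be≤N = b ^ suc e , m^n≢0 b (suc e) , be≤N , λ a a≤e _ →
  divides (b ^ (suc e ∸ a)) (trans (cong (b ^_) (sym (m∸n+n≡m a≤e))) (^-distribˡ-+-* b (suc e ∸ a) a))
... | no be≰N with powersOf N e b
...   | P , P≢0 , P≤N , h = P , P≢0 , P≤N , h′
  where
  h′ : ∀ a → a ≤ suc e → b ^ a ≤ N → b ^ a ∣ P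
  h′ a a≤ ba≤N with m≤n⇒m<n∨m≡n a≤
  ... | inj₁ (s≤s a≤e) = h a a≤e ba≤N
  ... | inj₂ refl = ⊥-elim (be≰N ba≤N)

-- Composite bases contribute a factor too. The crude bound `N ^ s` is affordable because `s` will
-- be about the square root of `N`.
powersUpTo : ∀ N e s .{{_ : NonZero N}} →
             ∃[ S ] (NonZero S × S ≤ N ^ s × (∀ b a → 0 < b → b ≤ s → a ≤ e → b ^ a ≤ N → b ^ a ∣ S))
powersUpTo N e zero = 1 , _ , ≤-refl , λ { _ _ (s≤s _) () }
powersUpTo N e (suc s) with powersOf N e (suc s) | powersUpTo N e s
... | P , P≢0 , P≤ , hP | S , S≢0 , S≤ , hS = P * S , m*n≢0 P S {{P≢0}} {{S≢0}} , *-mono-≤ P≤ S≤ , h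
  where
  h : ∀ b a → 0 < b → b ≤ suc s → a ≤ e → b ^ a ≤ N → b ^ a ∣ P * S
  h b a 0<b b≤ a≤e ba≤N with m≤n⇒m<n∨m≡n b≤
  ... | inj₁ (s≤s b≤s) = ∣n⇒∣m*n P (hS b a 0<b b≤s a≤e ba≤N)
  ... | inj₂ refl = ∣m⇒∣m*n S (hP a a≤e ba≤N)

-- A substitute for the primorial of 2 ^ t: the product of the (2 ^ (i + 1)) C (2 ^ i) for i < t.
primorialMultiple : ∀ t → ∃[ A ] (NonZero A × A ≤ 2 ^ 2 ^ suc t × (∀ p → Prime p → p ≤ 2 ^ t → p ∣ A))
primorialMultiple zero = 1 , _ , s≤s z≤n , λ p pp p≤1 → ⊥-elim (<⇒≱ (nonTrivial⇒n>1 p {{prime⇒nonTrivial pp}}) p≤1)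
primorialMultiple (suc t) with primorialMultiple t
... | A , A≢0 , A≤ , hA = A * c , m*n≢0 A c {{A≢0}} {{c≢0}} , bound , h
  where
  m = 2 ^ t
  c = (2 * m) C m
  c≢0 : NonZero c
  c≢0 = m*n≢0⇒m≢0 c {{subst NonZero (sym (nCk*k![n∸k]!≡n! (m≤m+n m (m + 0)))) ((2 * m) !≢0)}}
  bound : A * c ≤ 2 ^ 2 ^ suc (suc t)
  bound = begin
    A * c                         ≤⟨ *-mono-≤ A≤ (nCk≤2^n (2 * m) m) ⟩
    2 ^ 2 ^ suc t * 2 ^ 2 ^ suc t ≡⟨ ^-distribˡ-+-* 2 (2 ^ suc t) (2 ^ suc t) ⟨
    2 ^ (2 ^ suc t + 2 ^ suc t)   ≡⟨ cong (λ x → 2 ^ (2 ^ suc t + x)) (+-identityʳ (2 ^ suc t)) ⟨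
    2 ^ 2 ^ suc (suc t)           ∎
  h : ∀ p → Prime p → p ≤ 2 ^ suc t → p ∣ A * c
  h p pp p≤ with p ≤? m
  ... | yes p≤m = ∣m⇒∣m*n c (hA p pp p≤m)
  ... | no p≰m = ∣n⇒∣m*n A (prime∣2mCm m pp (≰⇒> p≰m) p≤)

-- Counting primes in an interval

-- The interval is `(m , n]`. Filtering by a decision procedure lets concrete intervals be counted
-- by evaluation.
primesBetween : ℕ → ℕ → List ℕ
primesBetween m n = filter prime? (applyUpTo (λ i → suc (m + i)) (n ∸ m))

primesBetween-unique : ∀ m n → Unique (primesBetween m n)
primesBetween-unique m n = Unique.filter⁺ prime?
  (Unique.applyUpTo⁺₁ (λ i → suc (m + i)) (n ∸ m) λ i<j _ eq → <⇒≢ i<j (+-cancelˡ-≡ m _ _ (suc-injective eq)))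

primesBetween-bounds : ∀ {m n} → m ≤ n → All (λ p → Prime p × m < p × p ≤ n) (primesBetween m n)
primesBetween-bounds {m} {n} m≤n = All.zip (All.all-filter prime? xs , All.filter⁺ prime? {xs = xs}
  (All.applyUpTo⁺₁ (λ i → suc (m + i)) (n ∸ m) λ {i} i< → s≤s (m≤m+n m i) ,
     subst (_≤ n) (+-suc m i) (≤-trans (+-monoʳ-≤ m i<) (≤-reflexive (m+[n∸m]≡n m≤n)))))
  where xs = applyUpTo (λ i → suc (m + i)) (n ∸ m)

∈-primesBetween : ∀ {m n p} → Prime p → m < p → p ≤ n → p ∈ primesBetween m n
∈-primesBetween {m} {n} {p} pp m<p p≤n = ∈-filter⁺ prime?
  (subst (_∈ applyUpTo (λ i → suc (m + i)) (n ∸ m)) p≡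
    (∈-applyUpTo⁺ (λ i → suc (m + i)) i<n∸m)) pp
  where
  i = p ∸ suc m
  p≡ : suc (m + i) ≡ p
  p≡ = m+[n∸m]≡n m<p
  i<n∸m : i < n ∸ m
  i<n∸m = +-cancelˡ-≤ m (suc i) (n ∸ m) (subst₂ _≤_ (sym (trans (+-suc m i) p≡)) (sym (m+[n∸m]≡n (≤-trans (<⇒≤ m<p) p≤n))) p≤n)

product≤^length : ∀ {N ps} → All (_≤ N) ps → product ps ≤ N ^ length ps
product≤^length All.[] = ≤-refl
product≤^length (p≤N All.∷ ps≤N) = *-mono-≤ p≤N (product≤^length ps≤N)

product-nonZero : ∀ {ps} → All NonZero ps → NonZero (product ps)
product-nonZero All.[] = _
product-nonZero {p ∷ ps} (p≢0 All.∷ ps≢0) = m*n≢0 p (product ps) {{p≢0}} {{product-nonZero ps≢0}}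

-- Compare exponents of 2 in `2 ^ (N - 1) ≤ q ≤ N ^ s * 2 ^ 2 ^ suc t * N ^ k`, where `N = 2 ^ w`.
-- The middle factor uses up half of the exponent `N`; the other half, `2 ^ suc t`, is left to be
-- bounded by `w * (s + k)` up to 1.
primeCount≥ : ∀ t h n → n ≤ 2 ^ t → 2 ^ (2 + t) ≤ 2 ^ h * 2 ^ h →
              2 ^ suc t ≤ suc ((2 + t) * (2 ^ h + length (primesBetween n (2 ^ (2 + t)))))
primeCount≥ t h n n≤2^t N≤s² = +-cancelʳ-≤ (2 ^ suc t) (2 ^ suc t) _ (begin
  2 ^ suc t + 2 ^ suc t                ≡⟨ double 2^[1+t]≡1+m ⟩
  suc (suc (2 * m))                    ≤⟨ s≤s exponents ⟩
  suc (w * s + 2 ^ suc t + w * k)      ≡⟨ regroup w s k (2 ^ suc t) ⟩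
  suc (w * (s + k)) + 2 ^ suc t        ∎)
  where
  w = 2 + t
  N = 2 ^ w
  s = 2 ^ h
  -- Chosen so that `2 * suc m` equals `N`, the form `commonMultiple≥` expects.
  m = 2 ^ suc t ∸ 1
  ps = primesBetween n N
  k = length ps
  2^[1+t]≡1+m : 2 ^ suc t ≡ suc m
  2^[1+t]≡1+m = sym (m+[n∸m]≡n (m^n>0 2 (suc t)))
  double : ∀ {x} → x ≡ suc m → x + x ≡ suc (suc (2 * m))
  double refl = trans (cong (suc m +_) (sym (+-identityʳ (suc m)))) (2[1+m]≡2+2m m)
  regroup : ∀ w s k x → suc (w * s + x + w * k) ≡ suc (w * (s + k)) + x
  regroup = solve-∀
  n≤N : n ≤ N
  n≤N = ≤-trans n≤2^t (^-monoʳ-≤ 2 (m≤n+m t 2))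
  psBounds = primesBetween-bounds n≤N
  instance
    N≢0 = m^n≢0 2 w
  small = powersUpTo N w s
  S = proj₁ small
  medium = primorialMultiple t
  A = proj₁ medium
  q = S * A * product ps
  instance
    S≢0 = proj₁ (proj₂ small)
    A≢0 = proj₁ (proj₂ medium)
    Π≢0 = product-nonZero (All.map (λ (pp , _) → prime⇒nonZero pp) psBounds)
    SA≢0 = m*n≢0 S A
    q≢0 = m*n≢0 (S * A) (product ps)
  S≤ : S ≤ N ^ s
  S≤ = proj₁ (proj₂ (proj₂ small))
  A≤ : A ≤ 2 ^ 2 ^ suc t
  A≤ = proj₁ (proj₂ (proj₂ medium))
  prime∣q : ∀ p → Prime p → p ≤ N → p ∣ q
  prime∣q p pp p≤N with p ≤? n
  ... | yes p≤n = ∣m⇒∣m*n (product ps) (∣n⇒∣m*n S (proj₂ (proj₂ (proj₂ medium)) p pp (≤-trans p≤n n≤2^t)))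
  ... | no p≰n = ∣n⇒∣m*n (S * A) (∈⇒∣product (∈-primesBetween pp (≰⇒> p≰n) p≤N))
  primePower∣q : ∀ p a → Prime p → p ^ a ≤ N → p ^ a ∣ q
  primePower∣q p zero pp _ = 1∣ q
  primePower∣q p (suc zero) pp p≤N = subst (_∣ q) (sym (*-identityʳ p)) (prime∣q p pp (subst (_≤ N) (*-identityʳ p) p≤N))
  -- With exponent at least 2, `p * p ≤ N ≤ s * s` makes `p` one of the bases of `S`, and `2 ≤ p`
  -- keeps the exponent within the cap `w`.
  primePower∣q p (suc (suc a)) pp p^a≤N =
    ∣m⇒∣m*n (product ps) (∣m⇒∣m*n A (proj₂ (proj₂ (proj₂ small)) p (2 + a) (<⇒≤ 1<p) p≤s a≤w p^a≤N))
    where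
    instance _ = prime⇒nonZero pp
    1<p = nonTrivial⇒n>1 p {{prime⇒nonTrivial pp}}
    p≤s : p ≤ s
    p≤s = ≮⇒≥ λ s<p → <⇒≱ (*-mono-< s<p s<p) (begin
      p * p             ≤⟨ *-monoʳ-≤ p (m≤m*n p (p ^ a) {{m^n≢0 p a}}) ⟩
      p * (p * p ^ a)   ≤⟨ p^a≤N ⟩
      N                 ≤⟨ N≤s² ⟩
      s * s             ∎)
    a≤w : 2 + a ≤ w
    a≤w = ≮⇒≥ λ w<a → <⇒≱ (^-monoʳ-< 2 ≤-refl w<a) (≤-trans (^-monoˡ-≤ (2 + a) 1<p) p^a≤N)
  ≤N⇒∣q : ∀ i → 1 ≤ i → i ≤ N → i ∣ q
  ≤N⇒∣q i 1≤i i≤N = primePowers∣⇒∣ q i λ p a pp pa∣i → primePower∣q p a pp (≤-trans (∣⇒≤ pa∣i) i≤N)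
    where instance _ = >-nonZero 1≤i
  exponents : suc (2 * m) ≤ w * s + 2 ^ suc t + w * k
  exponents = ≮⇒≥ λ lt → <⇒≱ (^-monoʳ-< 2 ≤-refl lt) (begin
    2 ^ suc (2 * m)
      ≤⟨ commonMultiple≥ m (λ i 1≤i i≤ → ≤N⇒∣q i 1≤i (subst (λ x → i ≤ 2 * x) (sym 2^[1+t]≡1+m) i≤)) ⟩
    S * A * product ps
      ≤⟨ *-mono-≤ (*-mono-≤ S≤ A≤) (product≤^length (All.map (λ (_ , _ , p≤N) → p≤N) psBounds)) ⟩
    N ^ s * 2 ^ 2 ^ suc t * N ^ k
      ≡⟨ cong₂ (λ x y → x * 2 ^ 2 ^ suc t * y) (^-*-assoc 2 w s) (^-*-assoc 2 w k) ⟩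
    2 ^ (w * s) * 2 ^ 2 ^ suc t * 2 ^ (w * k)
      ≡⟨ cong (_* 2 ^ (w * k)) (^-distribˡ-+-* 2 (w * s) (2 ^ suc t)) ⟨
    2 ^ (w * s + 2 ^ suc t) * 2 ^ (w * k)
      ≡⟨ ^-distribˡ-+-* 2 (w * s + 2 ^ suc t) (w * k) ⟨
    2 ^ (w * s + 2 ^ suc t + w * k)
      ∎)

-- Numerical estimates for the exponents

exponential-dominates : ∀ j → let h = 6 + j in 4 + 8 * (h * (2 ^ h + 17)) < 2 ^ h * 2 ^ h
-- At `h = 6` the margin is small, and at `h = 5` the inequality fails (1964 against 1024).
exponential-dominates zero = from-yes (3892 <? 4096)
exponential-dominates (suc j) = begin-strict
  4 + 8 * ((7 + j) * (2 * x + 17))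
    -- Raising `h` by 1 multiplies the right side by exactly 4. The summand added here is what the
    -- new left side lacks to be 4 times the old one.
    ≤⟨ m≤m+n _ (284 + 16 * ((5 + j) * x) + 408 * (5 + j)) ⟩
  4 + 8 * ((7 + j) * (2 * x + 17)) + (284 + 16 * ((5 + j) * x) + 408 * (5 + j))
    ≡⟨ expand j x ⟩
  4 * (4 + 8 * ((6 + j) * (x + 17)))
    <⟨ *-monoʳ-< 4 (exponential-dominates j) ⟩
  4 * (x * x)
    ≡⟨ square x ⟩
  2 * x * (2 * x)
    ∎
  where
  x = 2 ^ (6 + j)
  expand : ∀ j x → 4 + 8 * ((7 + j) * (2 * x + 17)) + (284 + 16 * ((5 + j) * x) + 408 * (5 + j))
                   ≡ 4 * (4 + 8 * ((6 + j) * (x + 17)))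
  expand = solve-∀
  square : ∀ x → 4 * (x * x) ≡ 2 * x * (2 * x)
  square = solve-∀

binaryBracket : ∀ n → ∃[ u ] (2 ^ u ≤ suc n × suc n < 2 ^ suc u)
binaryBracket zero = 0 , ≤-refl , ≤-refl
binaryBracket (suc n) with binaryBracket n
... | u , lo , hi with suc (suc n) <? 2 ^ suc u
...   | yes hi′ = u , m≤n⇒m≤1+n lo , hi′
...   | no  hi≮ = suc u , ≮⇒≥ hi≮ , ≤-<-trans hi (^-monoʳ-< 2 ≤-refl (n<1+n (suc u)))

n≤⌈n/2⌉+⌈n/2⌉ : ∀ n → n ≤ ⌈ n /2⌉ + ⌈ n /2⌉
n≤⌈n/2⌉+⌈n/2⌉ n = begin
  n                   ≡⟨ ⌊n/2⌋+⌈n/2⌉≡n n ⟨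
  ⌊ n /2⌋ + ⌈ n /2⌉   ≤⟨ +-monoˡ-≤ ⌈ n /2⌉ (⌊n/2⌋≤⌈n/2⌉ n) ⟩
  ⌈ n /2⌉ + ⌈ n /2⌉   ∎

⌈n/2⌉+⌈n/2⌉≤1+n : ∀ n → ⌈ n /2⌉ + ⌈ n /2⌉ ≤ suc n
⌈n/2⌉+⌈n/2⌉≤1+n n = begin
  ⌈ n /2⌉ + ⌈ n /2⌉       ≤⟨ +-monoʳ-≤ ⌈ n /2⌉ (⌊n/2⌋≤⌈n/2⌉ (suc n)) ⟩
  ⌈ n /2⌉ + ⌈ suc n /2⌉   ≡⟨ ⌊n/2⌋+⌈n/2⌉≡n (suc n) ⟩
  suc n                   ∎

-- Taking `h` as half of `w`, rounded up, gives `N ≤ s * s ≤ 2 * N`. The first inequality is what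
-- `primeCount≥` requires; the second turns `k ≤ 17` into an upper bound on `s * s` that contradicts
-- `exponential-dominates`.
eighteenPrimes : ∀ t n → 10 ≤ t → n ≤ 2 ^ t → 18 ≤ length (primesBetween n (2 ^ (2 + t)))
eighteenPrimes t n 10≤t n≤2^t = ≮⇒≥ λ { (s≤s k≤17) → <⇒≱ (dominates h≥6) (s²≤ k≤17) }
  where
  w = 2 + t
  h = ⌈ w /2⌉
  s = 2 ^ h
  k = length (primesBetween n (2 ^ w))
  h≥6 : 6 ≤ h
  h≥6 = ⌈n/2⌉-mono (s≤s (s≤s 10≤t))
  N≤s² : 2 ^ w ≤ s * s
  N≤s² = ≤-trans (^-monoʳ-≤ 2 (n≤⌈n/2⌉+⌈n/2⌉ w)) (≤-reflexive (^-distribˡ-+-* 2 h h))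
  dominates : ∀ {h} → 6 ≤ h → 4 + 8 * (h * (2 ^ h + 17)) < 2 ^ h * 2 ^ h
  dominates {h} 6≤h = subst (λ h → 4 + 8 * (h * (2 ^ h + 17)) < 2 ^ h * 2 ^ h) (m+[n∸m]≡n 6≤h) (exponential-dominates (h ∸ 6))
  quadruple : ∀ x → 2 * (2 * x) ≡ 4 * x
  quadruple = solve-∀
  regroup : ∀ h s → 4 * suc ((h + h) * (s + 17)) ≡ 4 + 8 * (h * (s + 17))
  regroup = solve-∀
  s²≤ : k ≤ 17 → s * s ≤ 4 + 8 * (h * (s + 17))
  s²≤ k≤17 = begin
    s * s                            ≡⟨ ^-distribˡ-+-* 2 h h ⟨
    2 ^ (h + h)                      ≤⟨ ^-monoʳ-≤ 2 (⌈n/2⌉+⌈n/2⌉≤1+n w) ⟩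
    2 * (2 * 2 ^ suc t)              ≡⟨ quadruple (2 ^ suc t) ⟩
    4 * 2 ^ suc t                    ≤⟨ *-monoʳ-≤ 4 (primeCount≥ t h n n≤2^t N≤s²) ⟩
    4 * suc (w * (s + k))            ≤⟨ *-monoʳ-≤ 4 (s≤s (*-mono-≤ (n≤⌈n/2⌉+⌈n/2⌉ w) (+-monoʳ-≤ s k≤17))) ⟩
    4 * suc ((h + h) * (s + 17))     ≡⟨ regroup h s ⟩
    4 + 8 * (h * (s + 17))           ∎

-- Covering all `n > 8` by intervals of primes

EighteenPrimes : ℕ → Set
EighteenPrimes n = Σ[ ps ∈ List ℕ ] (18 ≤ length ps × Unique ps × All (λ p → Prime p × n < p × p < 9 * n) ps)

-- One interval `(a , b]` serves every `n` from `c` to `a`: its primes exceed `a ≥ n` and stay below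
-- `9 * c ≤ 9 * n`.
fromInterval : ∀ {n} c a b → c ≤ n → n ≤ a → a ≤ b → b < 9 * c → 18 ≤ length (primesBetween a b) → EighteenPrimes n
fromInterval c a b c≤n n≤a a≤b b<9c 18≤ = primesBetween a b , 18≤ , primesBetween-unique a b ,
  All.map (λ (pp , a<p , p≤b) → pp , ≤-<-trans n≤a a<p , ≤-<-trans p≤b (<-≤-trans b<9c (*-monoʳ-≤ 9 c≤n)))
          (primesBetween-bounds a≤b)

-- Here `t = suc u` with `2 ^ u ≤ n < 2 ^ suc u`, so the interval ends at `8 * 2 ^ u ≤ 8 * n`. As
-- 512 is `2 ^ 9`, the hypothesis yields `t ≥ 10`.
large : ∀ n → 512 < n → EighteenPrimes n
large n@(suc n-1) 512<n with binaryBracket n-1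
... | u , 2^u≤n , n<2^[1+u] =
  fromInterval n n (2 ^ (3 + u)) ≤-refl ≤-refl (≤-trans n≤2^[1+u] (^-monoʳ-≤ 2 {suc u} {3 + u} (m≤n+m (suc u) 2)))
    (begin-strict
      2 ^ (3 + u)   ≡⟨ ^-distribˡ-+-* 2 3 u ⟩
      8 * 2 ^ u     ≤⟨ *-monoʳ-≤ 8 2^u≤n ⟩
      8 * n         <⟨ *-monoˡ-< n (n<1+n 8) ⟩
      9 * n         ∎)
    (eighteenPrimes (suc u) n 9<1+u n≤2^[1+u])
  where
  n≤2^[1+u] = <⇒≤ n<2^[1+u]
  9<1+u : 9 < suc u
  9<1+u = ≰⇒> λ 1+u≤9 → <⇒≱ 512<n (≤-trans n≤2^[1+u] (^-monoʳ-≤ 2 1+u≤9))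

theorem3p2p2 : (n : ℕ) → n > 8 →
    Σ[ ps ∈ List ℕ ] (18 ≤ length ps × Unique ps × All (λ p → Prime p × n < p × p < 9 * n) ps)
theorem3p2p2 n n>8 with n ≤? 10 | n ≤? 18 | n ≤? 78 | n ≤? 600
-- In each of the four cases `c` is one more than the previous `a` (at first 9) and `b` is
-- `9 * c - 1`. The value `a` is the largest possible: `(a , b]` has exactly 18 primes, the first
-- being `a + 1`, namely 11, 19, 79 and 601.
... | yes n≤10 | _ | _ | _ =
  fromInterval 9 10 80 n>8 n≤10 (from-yes (10 ≤? 80)) (from-yes (80 <? 81)) (from-yes (18 ≤? length (primesBetween 10 80)))
... | no n≰10 | yes n≤18 | _ | _ =
  fromInterval 11 18 98 (≰⇒> n≰10) n≤18 (from-yes (18 ≤? 98)) (from-yes (98 <? 99)) (from-yes (18 ≤? length (primesBetween 18 98)))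
... | no _ | no n≰18 | yes n≤78 | _ =
  fromInterval 19 78 170 (≰⇒> n≰18) n≤78 (from-yes (78 ≤? 170)) (from-yes (170 <? 171)) (from-yes (18 ≤? length (primesBetween 78 170)))
... | no _ | no _ | no n≰78 | yes n≤600 =
  fromInterval 79 600 710 (≰⇒> n≰78) n≤600 (from-yes (600 ≤? 710)) (from-yes (710 <? 711)) (from-yes (18 ≤? length (primesBetween 600 710)))
... | no _ | no _ | no _ | no n≰600 = large n (<-trans (from-yes (512 <? 600)) (≰⇒> n≰600))
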